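{- (The Isolating Lemma) Let $A=\{a_1,\dots,a_m\}$ be a finite set of cardinality $m$ and let $\mathcal{F}$ be a family of non-empty subsets of $A$. Let $r>2m$ and let $f:A\to\{1,\dots,r\}$ be a function that assigns to each element $a_i\in A$ ($1\le i\le m$) a value chosen independently and uniformly at random from the set $\{1,\dots,r\}$. Then $$\Pr_f[f\text{ is good for }\mathcal{F}]\ \ge\ \frac12 .$$
   Context: For a weight function $f:A\to\{1,\dots,r\}$ and $S\subseteq A$, the weight of $S$, denoted $f(S)$, is the sum of the weights of the elements of $S$, i.e. $f(S)=\sum_{a\in S}f(a)$. The weight function $f$ is good for $\mathcal{F}$ if there is exactly one minimum-weight set in $\mathcal{F}$ with respect to $f$; otherwise $f$ is bad for $\mathcal{F}$.
   Formalization: The family F is assumed to contain at least one set (for an empty family every f is bad and the claim fails), and membership of a subset in F is assumed decidable, which excluded middle always supplies. -}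

module Defs where

open import Data.Bool.Base using (if_then_else_)
open import Data.Fin.Base using (Fin; toℕ)
open import Data.Fin.Properties using (nonZeroIndex)
open import Data.Fin.Subset using (Subset)
open import Data.Fin.Subset.Properties using (anySubset?)
import Data.Bool.Properties as Bool
open import Data.Integer.Base using (1ℤ)
open import Data.List.Base as List using (List; []; _∷_)
open import Data.Nat.Base as ℕ using (ℕ; zero; suc)
import Data.Nat.Properties as ℕ
open import Data.Product.Base using (_×_; _,_)
open import Data.Product using (∃!)
open import Data.Rational.Base as ℚ using (ℚ; 0ℚ; 1ℚ)
open import Data.Vec.Base as Vec using (Vec; []; _∷_; lookup; tabulate)
open import Data.Vec.Properties using (≡-dec)
open import Level using (Level)
open import Relation.Binary.PropositionalEquality using (_≡_)
open import Relation.Nullary.Decidable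
  using (Dec; map′; _×-dec_; _→-dec_; ¬?; decidable-stable)
open import Relation.Unary using (Pred; Decidable)

private
  variable
    ℓ : Level
    m r : ℕ

-- The ground set A = {a₁,…,aₘ} is Fin m.

weight : (Fin m → ℕ) → Subset m → ℕ
weight f S = Vec.sum (tabulate λ i → if lookup S i then f i else 0)

IsMinimum : Pred (Subset m) ℓ → (Fin m → ℕ) → Pred (Subset m) ℓ
IsMinimum F f S = F S × (∀ T → F T → weight f S ℕ.≤ weight f T)

Good : Pred (Subset m) ℓ → (Fin m → ℕ) → Set ℓ
Good F f = ∃! _≡_ (IsMinimum F f)

private
  allSubsets? : {P : Pred (Subset m) ℓ} → Decidable P → Dec (∀ S → P S)
  allSubsets? P? = map′
    (λ ¬∃¬P S → decidable-stable (P? S) (λ ¬PS → ¬∃¬P (S , ¬PS)))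
    (λ ∀P (S , ¬PS) → ¬PS (∀P S))
    (¬? (anySubset? (λ S → ¬? (P? S))))

isMinimum? : {F : Pred (Subset m) ℓ} → Decidable F →
             (f : Fin m → ℕ) → Decidable (IsMinimum F f)
isMinimum? F? f S =
  F? S ×-dec allSubsets? (λ T → F? T →-dec (weight f S ℕ.≤? weight f T))

good? : {F : Pred (Subset m) ℓ} → Decidable F →
        (f : Fin m → ℕ) → Dec (Good F f)
good? F? f = anySubset? λ S →
  isMinimum? F? f S ×-dec
  map′ (λ unique {T} → unique T) (λ unique T → unique {T})
    (allSubsets? λ T → isMinimum? F? f T →-dec ≡-dec Bool._≟_ S T)

-- A function Fin m → {1,…,r} is stored as its table of values, so that
-- propositional equality of outcomes is extensional; the entry k : Fin r
-- stands for the value k + 1.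

Assignment : ℕ → ℕ → Set
Assignment m r = Vec (Fin r) m

value : Assignment m r → Fin m → ℕ
value a i = suc (toℕ (lookup a i))

assignments : ∀ m r → List (Assignment m r)
assignments zero    r = [] ∷ []
assignments (suc m) r =
  List.cartesianProductWith _∷_ (List.allFin r) (assignments m r)

uniform : Fin r → ℚ
uniform {r} k = (1ℤ ℚ./ r) {{nonZeroIndex k}}

-- Independence of the m values: the joint mass is the product of the
-- marginal masses.

mass : Assignment m r → ℚ
mass a = Vec.foldr′ ℚ._*_ 1ℚ (Vec.map uniform a)

Pr : {E : Pred (Assignment m r) ℓ} → Decidable E → ℚ
Pr {m} {r} E? =
  List.foldr ℚ._+_ 0ℚ (List.map mass (List.filter E? (assignments m r)))

{-# OPTIONS --safe #-}

-- If f is bad, some element i lies in one minimum-weight set S but not in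
-- another one T.  The weights of the other elements then determine f i, so
-- a bad assignment is encoded by such an i together with its values off i.
-- Hence at most m r^(m-1) of the r^m equiprobable assignments are bad, which
-- is at most half of them.
module Submission where

open import Defs
open import Data.Fin.Subset using (Subset; Nonempty)
open import Data.Nat.Base using (ℕ; _*_; _>_)
open import Data.Rational.Base using (½; _≥_)
open import Level using (Level)
open import Relation.Unary using (Pred; Decidable; Satisfiable)

open import Algebra.Bundles using (CommutativeRing)
import Algebra.Properties.CommutativeMonoid.Sum as Sum
import Algebra.Properties.Semiring.Mult as Mult
import Data.Bool.Properties as Bool
open import Data.Bool.Base using (true; false; if_then_else_)
open import Data.Fin.Base using (Fin; zero; suc; toℕ; fromℕ<; punchIn; punchOut; combine; funToFin; finToFun)
open import Data.Fin.Properties as Fin using (punchIn-punchOut; combine-injective; finToFun-funToFin; injective⇒≤)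
open import Data.Fin.Subset.Properties using (anySubset?)
open import Data.Integer.Base as ℤ using (1ℤ)
import Data.Integer.Properties as ℤ
open import Data.List.Base as List using (List; []; _∷_; length; filter)
import Data.List.Properties as List
open import Data.List.Relation.Unary.All using (All; []; _∷_)
import Data.List.Relation.Unary.All as All
open import Data.List.Relation.Unary.All.Properties using (all-filter)
open import Data.List.Membership.Propositional.Properties using (∈-lookup)
open import Data.List.Relation.Unary.AllPairs using ([]; _∷_)
open import Data.List.Relation.Unary.Unique.Propositional using (Unique)
import Data.List.Relation.Unary.Unique.Propositional.Properties as Unique
open import Data.Nat.Base as ℕ using (zero; suc; _+_; _^_; _≤_; _<_; z≤n; s≤s)
open import Data.Nat.Induction using (<-wellFounded)
import Data.Nat.Properties as ℕ
open import Data.Product.Base using (∃; ∃₂; _×_; _,_)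
open import Data.Rational.Base as ℚ using (ℚ; 0ℚ; 1ℚ; NonNegative; toℚᵘ)
import Data.Rational.Properties as ℚ
open import Data.Rational.Unnormalised.Base as ℚᵘ using (mkℚᵘ; *≡*)
import Data.Rational.Unnormalised.Properties as ℚᵘ
open import Data.Sum.Base using (_⊎_; inj₁; inj₂)
open import Data.Vec.Base as Vec using (Vec; []; _∷_; lookup; tabulate; replicate)
open import Data.Vec.Properties using (≡-dec; ∷-injective)
open import Function.Base using (_∘_; id)
open import Induction.WellFounded using (Acc; acc)
open import Relation.Binary.PropositionalEquality
open import Relation.Nullary using (¬_; yes; no; contradiction)
open import Relation.Nullary.Decidable using (_×-dec_; ¬?; decidable-stable)
open import Relation.Unary.Properties using (∁?)

open Sum ℕ.+-0-commutativeMonoid using (sum; sum-remove; sum-cong-≗)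
open Mult (CommutativeRing.semiring ℚ.+-*-commutativeRing)
  using (×-homo-+; ×-assoc-*; ×-comm-*; ×-assocˡ) renaming (_×_ to _·_)

private
  variable
    ℓ : Level
    m n r : ℕ
    A : Set ℓ

-- Minimum-weight sets

contribution : (Fin m → ℕ) → Subset m → Fin m → ℕ
contribution f S i = if lookup S i then f i else 0

weightOff : Fin (suc m) → (Fin (suc m) → ℕ) → Subset (suc m) → ℕ
weightOff i f S = sum (contribution f S ∘ punchIn i)

-- The indices other than `i` are the image of `punchIn i`, so the values off `i` form a function on
-- `Fin m`, which can later be numbered.
AgreeOff : Fin (suc m) → (f g : Fin (suc m) → A) → Set _
AgreeOff i f g = ∀ j → f (punchIn i j) ≡ g (punchIn i j)

-- Carries `weight` over to sums indexed by `Fin m`, where `sum-remove` splits off the term at a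
-- chosen index.
sum-tabulate : (t : Fin m → ℕ) → Vec.sum (tabulate t) ≡ sum t
sum-tabulate {zero}  t = refl
sum-tabulate {suc m} t = cong (t zero +_) (sum-tabulate (t ∘ suc))

weight-split : ∀ i (f : Fin (suc m) → ℕ) S →
               weight f S ≡ contribution f S i + weightOff i f S
weight-split i f S = trans (sum-tabulate (contribution f S)) (sum-remove (contribution f S))

weight-∈ : ∀ i (f : Fin (suc m) → ℕ) S → lookup S i ≡ true →
           weight f S ≡ f i + weightOff i f S
weight-∈ i f S i∈S =
  trans (weight-split i f S)
        (cong (λ b → (if b then f i else 0) + weightOff i f S) i∈S)

weight-∉ : ∀ i (f : Fin (suc m) → ℕ) S → lookup S i ≡ false →
           weight f S ≡ weightOff i f S
weight-∉ i f S i∉S =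
  trans (weight-split i f S)
        (cong (λ b → (if b then f i else 0) + weightOff i f S) i∉S)

weightOff-cong : ∀ i (f g : Fin (suc m) → ℕ) S → AgreeOff i f g →
                 weightOff i f S ≡ weightOff i g S
weightOff-cong i f g S f≗g =
  sum-cong-≗ λ j → cong (λ w → if lookup S (punchIn i j) then w else 0) (f≗g j)

-- For such an `i`, `f i` equals a threshold fixed by the values off `i`: the least weight among
-- members of `F` avoiding `i`, minus the least off-`i` weight among members containing `i`.
Ambiguous : Pred (Subset m) ℓ → (Fin m → ℕ) → Fin m → Set ℓ
Ambiguous F f i = ∃₂ λ S T →
  (IsMinimum F f S × lookup S i ≡ true) × (IsMinimum F f T × lookup T i ≡ false)

-- Take `S` containing `i` and minimal for `f`, and `T` avoiding `i` and minimal for `g`. The weight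
-- of `T` ignores the value at `i`, so it is the same under `f` and `g` and links the two minimality
-- inequalities; cancelling the off-`i` weight of `S` leaves the values at `i`.
ambiguous-≤ : (F : Pred (Subset (suc m)) ℓ) (f g : Fin (suc m) → ℕ) (i : Fin (suc m)) →
              AgreeOff i f g → Ambiguous F f i → Ambiguous F g i → f i ≤ g i
ambiguous-≤ F f g i f≗g (S , _ , ((FS , S-min) , i∈S) , _)
                            (_ , T , _ , ((FT , T-min) , i∉T)) =
  ℕ.+-cancelʳ-≤ (weightOff i f S) (f i) (g i) (begin
    f i + weightOff i f S ≡⟨ weight-∈ i f S i∈S ⟨
    weight f S            ≤⟨ S-min T FT ⟩
    weight f T            ≡⟨ weight-∉ i f T i∉T ⟩
    weightOff i f T       ≡⟨ weightOff-cong i f g T f≗g ⟩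
    weightOff i g T       ≡⟨ weight-∉ i g T i∉T ⟨
    weight g T            ≤⟨ T-min S FS ⟩
    weight g S            ≡⟨ weight-∈ i g S i∈S ⟩
    g i + weightOff i g S ≡⟨ cong (g i +_) (weightOff-cong i f g S f≗g) ⟨
    g i + weightOff i f S ∎)
  where open ℕ.≤-Reasoning

ambiguous-≡ : (F : Pred (Subset (suc m)) ℓ) (f g : Fin (suc m) → ℕ) (i : Fin (suc m)) →
              AgreeOff i f g → Ambiguous F f i → Ambiguous F g i → f i ≡ g i
ambiguous-≡ F f g i f≗g fᵢ gᵢ =
  ℕ.≤-antisym (ambiguous-≤ F f g i f≗g fᵢ gᵢ) (ambiguous-≤ F g f i (sym ∘ f≗g) gᵢ fᵢ)

-- Well-founded descent on the weight: as long as a decidable search finds a lighter member of `F`,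
-- move to it.
minimum-exists : {F : Pred (Subset m) ℓ} → Decidable F → Satisfiable F →
                 ∀ f → ∃ (IsMinimum F f)
minimum-exists {F = F} F? (S₀ , FS₀) f = descend S₀ FS₀ (<-wellFounded _)
  where
  descend : ∀ S → F S → Acc _<_ (weight f S) → ∃ (IsMinimum F f)
  descend S FS (acc smaller) with anySubset? (λ T → F? T ×-dec weight f T ℕ.<? weight f S)
  ... | yes (T , FT , T<S) = descend T FT (smaller T<S)
  ... | no  S-least        = S , FS , λ T FT → ℕ.≮⇒≥ λ T<S → S-least (T , FT , T<S)

distinguish : ∀ (S T : Subset m) → S ≢ T →
              ∃ λ i → (lookup S i ≡ true × lookup T i ≡ false)
                    ⊎ (lookup T i ≡ true × lookup S i ≡ false)
distinguish [] [] S≢T = contradiction refl S≢T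
distinguish (true  ∷ S) (false ∷ T) _ = zero , inj₁ (refl , refl)
distinguish (false ∷ S) (true  ∷ T) _ = zero , inj₂ (refl , refl)
distinguish (true  ∷ S) (true  ∷ T) S≢T with i , p ← distinguish S T (S≢T ∘ cong (true ∷_))
  = suc i , p
distinguish (false ∷ S) (false ∷ T) S≢T with i , p ← distinguish S T (S≢T ∘ cong (false ∷_))
  = suc i , p

-- Search for a minimum-weight set other than `S`. Failure makes `S` unique, against badness;
-- success yields two minima, and whichever of them contains a distinguishing element takes the
-- first role in `Ambiguous`.
bad⇒ambiguous : {F : Pred (Subset m) ℓ} → Decidable F → Satisfiable F →
                ∀ f → ¬ Good F f → ∃ (Ambiguous F f)
bad⇒ambiguous F? F-sat f bad
  with S , S-min ← minimum-exists F? F-sat f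
  with anySubset? (λ T → isMinimum? F? f T ×-dec ¬? (≡-dec Bool._≟_ S T))
... | no  ∄T = contradiction
                 (S , S-min , λ {T} T-min →
                   decidable-stable (≡-dec Bool._≟_ S T) λ S≢T → ∄T (T , T-min , S≢T))
                 bad
... | yes (T , T-min , S≢T) with distinguish S T S≢T
...   | i , inj₁ (i∈S , i∉T) = i , S , T , (S-min , i∈S) , (T-min , i∉T)
...   | i , inj₂ (i∈T , i∉S) = i , T , S , (T-min , i∈T) , (S-min , i∉S)

-- Counting bad assignments

length-filter-∁ : {A : Set} {P : Pred A ℓ} (P? : Decidable P) (xs : List A) →
                  length (filter P? xs) + length (filter (∁? P?) xs) ≡ length xs
length-filter-∁ P? []       = refl
length-filter-∁ P? (x ∷ xs) with P? x
... | yes _ = cong suc (length-filter-∁ P? xs)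
... | no  _ = trans (ℕ.+-suc _ _) (cong suc (length-filter-∁ P? xs))

unique⇒lookup-injective : {xs : List A} → Unique xs →
                          ∀ i j → List.lookup xs i ≡ List.lookup xs j → i ≡ j
unique⇒lookup-injective (_ ∷ _)    zero    zero    _  = refl
unique⇒lookup-injective (x∉xs ∷ _) zero    (suc j) eq =
  contradiction eq (All.lookup x∉xs (∈-lookup j))
unique⇒lookup-injective (x∉xs ∷ _) (suc i) zero    eq =
  contradiction (sym eq) (All.lookup x∉xs (∈-lookup i))
unique⇒lookup-injective (_ ∷ xs!)  (suc i) (suc j) eq =
  cong suc (unique⇒lookup-injective xs! i j eq)

-- Without repetitions, distinct positions hold distinct entries, so coding the entries embeds the
-- positions of `xs` into `Fin n`. Since the code may depend on the proof of `P`, injectivity is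
-- required across any two proofs.
unique⇒length≤ : {A : Set} {P : Pred A ℓ} {xs : List A} → Unique xs → All P xs →
                 (code : ∃ P → Fin n) →
                 (∀ {x y} (p : P x) (q : P y) → code (x , p) ≡ code (y , q) → x ≡ y) →
                 length xs ≤ n
unique⇒length≤ {xs = xs} xs! Pxs code code-injective =
  injective⇒≤ {f = λ i → code (_ , Pxᵢ i)} λ {i} {j} eq →
    unique⇒lookup-injective xs! i j (code-injective (Pxᵢ i) (Pxᵢ j) eq)
  where
  Pxᵢ = λ i → All.lookup Pxs (∈-lookup {xs = xs} i)

assignments-unique : ∀ m r → Unique (assignments m r)
assignments-unique zero    r = [] ∷ []
assignments-unique (suc m) r =
  Unique.cartesianProductWith⁺ _∷_ ∷-injective (Unique.allFin⁺ r) (assignments-unique m r)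

length-assignments : ∀ m r → length (assignments m r) ≡ r ^ m
length-assignments zero    r = refl
length-assignments (suc m) r =
  trans (length-product _∷_ (List.allFin r) (assignments m r))
        (cong₂ _*_ {u = length (assignments m r)} (List.length-tabulate {n = r} id)
          (length-assignments m r))
  where
  length-product : {A B C : Set} (f : A → B → C) (xs : List A) (ys : List B) →
    length (List.cartesianProductWith f xs ys) ≡ length xs * length ys
  length-product f []       ys = refl
  length-product f (x ∷ xs) ys =
    trans (List.length-++ (List.map (f x) ys))
          (cong₂ _+_ (List.length-map (f x) ys) (length-product f xs ys))

lookup-injective : (xs ys : Vec A n) → (∀ i → lookup xs i ≡ lookup ys i) → xs ≡ ys
lookup-injective []       []       eq = refl
lookup-injective (x ∷ xs) (y ∷ ys) eq =
  cong₂ _∷_ (eq zero) (lookup-injective xs ys (eq ∘ suc))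

agreeOff-extend : ∀ i (f g : Fin (suc m) → A) → AgreeOff i f g → f i ≡ g i → ∀ j → f j ≡ g j
agreeOff-extend i f g f≗g fᵢ≡gᵢ j with i Fin.≟ j
... | yes refl = fᵢ≡gᵢ
... | no  i≢j  = subst (λ k → f k ≡ g k) (punchIn-punchOut i≢j) (f≗g (punchOut i≢j))

module _ {F : Pred (Subset (suc m)) ℓ} (F? : Decidable F) (F-sat : Satisfiable F) (r : ℕ) where

  -- `funToFin` reads the values off `i` as the digits of a number below `r ^ m`, and `combine`
  -- pairs it with `i`.
  badCode : ∃ (λ (a : Assignment (suc m) r) → ¬ Good F (value a)) → Fin (suc m * r ^ m)
  badCode (a , bad) with i , _ ← bad⇒ambiguous F? F-sat (value a) bad =
    combine i (funToFin (lookup a ∘ punchIn i))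

  badCode-injective : ∀ {a b} p q → badCode (a , p) ≡ badCode (b , q) → a ≡ b
  badCode-injective {a} {b} p q eq
    with i , aᵢ ← bad⇒ambiguous F? F-sat (value a) p
       | j , bⱼ ← bad⇒ambiguous F? F-sat (value b) q
    -- Equal codes name the same ambiguous element, so both assignments can be compared at one `i`.
    with refl , eq′ ← combine-injective i _ j _ eq =
    lookup-injective a b (agreeOff-extend i (lookup a) (lookup b) a≗b
      -- The entry stored for a weight is one less than the weight, hence the `suc` to strip.
      (Fin.toℕ-injective (ℕ.suc-injective
        (ambiguous-≡ F (value a) (value b) i (cong (suc ∘ toℕ) ∘ a≗b) aᵢ bⱼ))))
    where
    a≗b : AgreeOff i (lookup a) (lookup b)
    a≗b k = begin
      lookup a (punchIn i k)                              ≡⟨ finToFun-funToFin (lookup a ∘ punchIn i) k ⟨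
      finToFun (funToFin (lookup a ∘ punchIn i)) k        ≡⟨ cong (λ c → finToFun c k) eq′ ⟩
      finToFun (funToFin (lookup b ∘ punchIn i)) k        ≡⟨ finToFun-funToFin (lookup b ∘ punchIn i) k ⟩
      lookup b (punchIn i k)                              ∎
      where open ≡-Reasoning

  IsGood IsBad : Pred (Assignment (suc m) r) ℓ
  IsGood a = Good F (value a)
  IsBad a  = ¬ IsGood a

  isGood? : Decidable IsGood
  isGood? a = good? F? (value a)

  good bad : List (Assignment (suc m) r)
  good = filter isGood? (assignments (suc m) r)
  bad  = filter (∁? isGood?) (assignments (suc m) r)

  good+bad : length good + length bad ≡ r ^ suc m
  good+bad = trans (length-filter-∁ isGood? (assignments (suc m) r))
                   (length-assignments (suc m) r)

  bad-unique : Unique bad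
  bad-unique = Unique.filter⁺ (∁? isGood?) (assignments-unique (suc m) r)

  bad-isBad : All IsBad bad
  bad-isBad = all-filter (∁? isGood?) (assignments (suc m) r)

  bad-count : length bad ≤ suc m * r ^ m
  bad-count = unique⇒length≤ {P = IsBad} bad-unique bad-isBad badCode
    λ {a} {b} → badCode-injective {a} {b}

  -- Twice the bound on the bad assignments is at most the number of all assignments, and one copy
  -- of the bad ones cancels.
  bad≤good : r > 2 * suc m → length bad ≤ length good
  bad≤good r>2m = ℕ.+-cancelʳ-≤ (length bad) (length bad) (length good) (begin
    length bad + length bad  ≡⟨ cong (length bad +_) (ℕ.+-identityʳ (length bad)) ⟨
    2 * length bad           ≤⟨ ℕ.*-monoʳ-≤ 2 bad-count ⟩
    2 * (suc m * r ^ m)      ≡⟨ ℕ.*-assoc 2 (suc m) (r ^ m) ⟨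
    2 * suc m * r ^ m        ≤⟨ ℕ.*-monoˡ-≤ (r ^ m) (ℕ.<⇒≤ r>2m) ⟩
    r ^ suc m                ≡⟨ good+bad ⟨
    length good + length bad ∎)
    where open ℕ.≤-Reasoning

-- The uniform measure

-- Here `_·_` is repeated addition. The induction step is checked on unnormalised fractions, where
-- it reduces to an integer identity by cross-multiplication.
·-1/ : ∀ n d .{{_ : ℕ.NonZero d}} → n · (1ℤ ℚ./ d) ≡ ℤ.+ n ℚ./ d
·-1/ zero    (suc d) = sym (ℚ.fromℚᵘ-cong {mkℚᵘ (ℤ.+ 0) d} {mkℚᵘ (ℤ.+ 0) 0} (*≡* refl))
·-1/ (suc n) (suc d) = trans (cong (1ℤ ℚ./ suc d ℚ.+_) (·-1/ n (suc d)))
  (ℚ.toℚᵘ-injective (begin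
    toℚᵘ (1ℤ ℚ./ suc d ℚ.+ ℤ.+ n ℚ./ suc d)
      ≈⟨ ℚ.toℚᵘ-homo-+ (1ℤ ℚ./ suc d) (ℤ.+ n ℚ./ suc d) ⟩
    toℚᵘ (1ℤ ℚ./ suc d) ℚᵘ.+ toℚᵘ (ℤ.+ n ℚ./ suc d)
      ≈⟨ ℚᵘ.+-cong (ℚ.toℚᵘ-fromℚᵘ (mkℚᵘ 1ℤ d)) (ℚ.toℚᵘ-fromℚᵘ (mkℚᵘ (ℤ.+ n) d)) ⟩
    mkℚᵘ 1ℤ d ℚᵘ.+ mkℚᵘ (ℤ.+ n) d
      ≈⟨ *≡* (numerators-add n (suc d)) ⟩
    mkℚᵘ (ℤ.+ suc n) d
      ≈⟨ ℚ.toℚᵘ-fromℚᵘ (mkℚᵘ (ℤ.+ suc n) d) ⟨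
    toℚᵘ (ℤ.+ suc n ℚ./ suc d) ∎))
  where
  open ℚᵘ.≃-Reasoning
  numerators-add : ∀ n d → (1ℤ ℤ.* ℤ.+ d ℤ.+ ℤ.+ n ℤ.* ℤ.+ d) ℤ.* ℤ.+ d ≡ ℤ.+ suc n ℤ.* ℤ.+ (d * d)
  numerators-add n d = trans (cong₂ ℤ._*_ (sym (ℤ.*-distribʳ-+ (ℤ.+ d) 1ℤ (ℤ.+ n))) refl)
    (trans (ℤ.*-assoc (ℤ.+ suc n) (ℤ.+ d) (ℤ.+ d)) (cong (ℤ.+ suc n ℤ.*_) (sym (ℤ.pos-* d d))))

n·1/n≡1 : ∀ n .{{_ : ℕ.NonZero n}} → n · (1ℤ ℚ./ n) ≡ 1ℚ
n·1/n≡1 (suc n) = trans (·-1/ (suc n) (suc n))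
  (ℚ.fromℚᵘ-cong {mkℚᵘ (ℤ.+ suc n) n} {mkℚᵘ 1ℤ 0} (*≡* (ℤ.*-comm (ℤ.+ suc n) 1ℤ)))

mass-constant : (a b : Assignment m r) → mass a ≡ mass b
mass-constant []      []      = refl
-- The index enters `uniform` only through an irrelevant proof that `r` is nonzero, so `uniform k`
-- and `uniform l` are convertible.
mass-constant (k ∷ a) (l ∷ b) = cong (uniform k ℚ.*_) (mass-constant a b)

mass-nonNegative : (a : Assignment m r) → NonNegative (mass a)
mass-nonNegative []      = _
mass-nonNegative {r = r} (k ∷ a) = ℚ.nonNeg*nonNeg⇒nonNeg
  (uniform k) {{ℚ.normalize-nonNeg 1 r {{Fin.nonZeroIndex k}}}} (mass a) {{mass-nonNegative a}}

·-homo-* : ∀ k l x y → (k * l) · (x ℚ.* y) ≡ (k · x) ℚ.* (l · y)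
·-homo-* k l x y = begin
  (k * l) · (x ℚ.* y)   ≡⟨ ×-assocˡ (x ℚ.* y) k l ⟨
  k · (l · (x ℚ.* y))   ≡⟨ cong (k ·_) (×-comm-* l x y) ⟨
  k · (x ℚ.* (l · y))   ≡⟨ ×-assoc-* k x (l · y) ⟨
  (k · x) ℚ.* (l · y)   ∎
  where open ≡-Reasoning

-- The `r ^ m` copies distribute over the product of marginals, one factor `r` to each, and every
-- `r · (1/r)` is 1.
total-mass : (a : Assignment m r) → (r ^ m) · mass a ≡ 1ℚ
total-mass []      = refl
total-mass {suc m} {r} (k ∷ a) = trans (·-homo-* r (r ^ m) (uniform k) (mass a))
  (cong₂ ℚ._*_ (n·1/n≡1 r {{Fin.nonZeroIndex k}}) (total-mass a))

sum-mass : (xs : List (Assignment m r)) (a : Assignment m r) →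
           List.foldr ℚ._+_ 0ℚ (List.map mass xs) ≡ length xs · mass a
sum-mass []       a = refl
sum-mass (x ∷ xs) a = cong₂ ℚ._+_ (mass-constant x a) (sum-mass xs a)

·-monoˡ-≤ : ∀ x .{{_ : NonNegative x}} {k l} → k ≤ l → k · x ℚ.≤ l · x
·-monoˡ-≤ x {l = l} z≤n = nonNegative l
  where
  nonNegative : ∀ l → 0ℚ ℚ.≤ l · x
  nonNegative zero    = ℚ.≤-refl
  nonNegative (suc l) = ℚ.+-mono-≤ (ℚ.nonNegative⁻¹ x) (nonNegative l)
·-monoˡ-≤ x (s≤s k≤l) = ℚ.+-monoʳ-≤ x (·-monoˡ-≤ x k≤l)

1≤p+p⇒½≤p : ∀ p → 1ℚ ℚ.≤ p ℚ.+ p → ½ ℚ.≤ p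
1≤p+p⇒½≤p p 1≤p+p = ℚ.≮⇒≥ λ p<½ → ℚ.<-irrefl refl (ℚ.<-≤-trans (ℚ.+-mono-< p<½ p<½) 1≤p+p)

theorem2p60 : {ℓ : Level} (m : ℕ) (F : Pred (Subset m) ℓ) (F? : Decidable F) →
    Satisfiable F →
    (∀ S → F S → Nonempty S) →
    (r : ℕ) → r > 2 * m →
    Pr {m} {r} (λ a → good? F? (value a)) ≥ ½
-- A nonempty member of `F` would supply an element of `Fin 0`.
theorem2p60 zero    F F? (S , FS) nonempty r r>2m with () , _ ← nonempty S FS
theorem2p60 (suc m) F F? F-sat nonempty r r>2m =
  -- The probability is `#good · q`. The total mass 1 splits into good and bad mass, and the bad
  -- mass is at most the good, so twice the probability is at least 1.
  subst (½ ℚ.≤_) (sym (sum-mass (good F? F-sat r) a)) (1≤p+p⇒½≤p (#good · q) (begin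
    1ℚ                      ≡⟨ total-mass a ⟨
    (r ^ suc m) · q         ≡⟨ cong (_· q) (good+bad F? F-sat r) ⟨
    (#good + #bad) · q      ≡⟨ ×-homo-+ q #good #bad ⟩
    #good · q ℚ.+ #bad · q  ≤⟨ ℚ.+-monoʳ-≤ (#good · q)
                                (·-monoˡ-≤ q {{mass-nonNegative a}} (bad≤good F? F-sat r r>2m)) ⟩
    #good · q ℚ.+ #good · q ∎))
  where
  open ℚ.≤-Reasoning
  a : Assignment (suc m) r
  -- A reference assignment for the common mass `q`; the bound on `r` makes `r` positive, so the
  -- index 0 exists.
  a = replicate (suc m) (fromℕ< (ℕ.≤-<-trans z≤n r>2m))
  q = mass a
  #good = length (good F? F-sat r)
  #bad  = length (bad F? F-sat r)
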